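{- Let $(\sigma',u')$ and $(\sigma'',u'')$ be colored permutations. Then $$\mathbf G_{\sigma',u'}\,\mathbf G_{\sigma'',u''}=\sum_{\sigma\in\sigma'*\sigma''}\mathbf G_{\sigma,\,u'\cdot u''},$$ where $u'\cdot u''$ is the concatenation of the words $u'$ and $u''$. Therefore the dual free $l$-quasi-ribbons $\mathbf G_{\sigma,u}$, where $(\sigma,u)$ runs over all colored permutations, span a $\mathbb Z$-subalgebra of the free associative algebra $\mathbb Z\langle A\rangle$.
   Context: Fix an integer $l\ge1$, a set of colors $C=\{c_0,\dots,c_{l-1}\}$ with $l$ elements, and the infinite ordered alphabet $B=\{1<2<3<\cdots\}$. Let $A=B\times C$ be the $l$-colored alphabet. A word $w$ of length $n$ over $A$ is written as a pair $(v,u)$ with $v\in B^n$, $u\in C^n$. Since $A$ is infinite, elements of $\mathbb Z\langle A\rangle$ are here allowed to be infinite $\mathbb Z$-linear combinations of words of bounded length, with the usual concatenation product. The standardization $\mathrm{Std}(v)\in\mathfrak S_n$ of a word $v\in B^n$ is the permutation obtained by scanning $v$ from left to right and labelling $1,2,\dots$ the occurrences of its smallest letter, then continuing the numbering with the occurrences of the next smallest letter (again from left to right), and so on. The colored standardization of $w=(v,u)$ is $\mathbf{Std}(w)=(\mathrm{Std}(v),u)$. A colored permutation of size $n\ge 0$ is a pair $(\sigma,u)$ with $\sigma\in\mathfrak S_n$ and $u\in C^n$. The dual free $l$-quasi-ribbon is $$\mathbf G_{\sigma,u}=\sum_{w\in A^n;\ \mathbf{Std}(w)=(\sigma,u)}w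 .$$ The convolution $\sigma'*\sigma''$ of permutations $\sigma'\in\mathfrak S_p$ and $\sigma''\in\mathfrak S_q$ is the set of permutations $\tau\in\mathfrak S_{p+q}$ (written as words $\tau(1)\cdots\tau(p+q)$) such that the standardization of the first $p$ letters of $\tau$ is $\sigma'$ and the standardization of the last $q$ letters of $\tau$ is $\sigma''$. -}

module Defs where

open import Algebra.Bundles using (Ring)
open import Data.Bool.Base using (if_then_else_)
open import Data.Fin.Base using (Fin; zero; suc; toℕ; punchIn)
import Data.Fin.Properties as Finₚ
open import Data.Fin.Permutation as Perm
  using (Permutation; Permutation′; permutation; insert; remove; insert-remove;
         insert-punchIn; cast-id; flip; _∘ₚ_; ↔⇒≡; _⟨$⟩ʳ_)
open import Data.Integer.Base as ℤ using (ℤ; 0ℤ; 1ℤ)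
import Data.Integer.Properties as ℤₚ
open import Data.List.Base as List
  using (List; []; _∷_; length; foldr; filter; concatMap; upTo; allFin)
open import Data.List.Membership.Propositional using (_∈_)
open import Data.List.Membership.Propositional.Properties
  using (∈-lookup; ∈-concatMap⁺; ∈-filter⁺; ∈-filter⁻; ∈-upTo⁺; ∈-allFin)
import Data.List.Properties as Listₚ
open import Data.List.Relation.Unary.All as All using (All; []; _∷_)
import Data.List.Relation.Unary.All.Properties as Allₚ
open import Data.List.Relation.Unary.AllPairs as AllPairs using (AllPairs; []; _∷_)
import Data.List.Relation.Unary.AllPairs.Properties as AllPairsₚ
open import Data.List.Relation.Unary.Any as Any using (Any; here)
import Data.List.Relation.Unary.Any.Properties as Anyₚ
open import Data.List.Relation.Unary.Unique.Propositional using (Unique)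
import Data.List.Relation.Unary.Unique.Propositional.Properties as Uniqueₚ
open import Data.Nat.Base as ℕ using (ℕ; zero; suc; _⊔_; _≤_; _<_; s≤s)
import Data.Nat.Properties as ℕₚ
open import Data.Product.Base using (_×_; _,_; proj₁; proj₂; ∃)
open import Data.Vec.Base as Vec using (Vec; []; _∷_)
import Data.Vec.Properties as Vecₚ
open import Function.Base using (_∘_)
open import Level using (0ℓ)
open import Relation.Binary.Definitions using (Decidable)
open import Relation.Binary.PropositionalEquality
open import Relation.Nullary using (Dec; yes; no; ¬_; contradiction)
open import Relation.Nullary.Decidable using (⌊_⌋; _×-dec_; map′)

------------------------------------------------------------------------
-- ℤ⟨X⟩: possibly infinite ℤ-linear combinations of words of bounded length,
-- given by the coefficient of each word.

record ℤ⟨_⟩ (X : Set) : Set where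
  constructor mk
  field
    coeff   : List X → ℤ
    bounded : ∃ λ N → ∀ w → N < length w → coeff w ≡ 0ℤ

open ℤ⟨_⟩ public

sumℤ : List ℤ → ℤ
sumℤ = foldr ℤ._+_ 0ℤ

-- All pairs (x , y) with w = x · y.
splits : {X : Set} → List X → List (List X × List X)
splits []      = ([] , []) ∷ []
splits (a ∷ w) = ([] , a ∷ w) ∷ List.map (λ (x , y) → (a ∷ x , y)) (splits w)

-- The coefficient of w in the concatenation product of Σ f x · x and Σ g y · y.
conv : {X : Set} → (List X → ℤ) → (List X → ℤ) → List X → ℤ
conv f g w = sumℤ (List.map (λ (x , y) → f x ℤ.* g y) (splits w))

module _ {X : Set} where

  private
    Coeffs : Set
    Coeffs = List X → ℤ

    infixl 6 _⊕_
    _⊕_ : Coeffs → Coeffs → Coeffs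
    (f ⊕ g) w = f w ℤ.+ g w

    infixr 7 _⊙_
    _⊙_ : ℤ → Coeffs → Coeffs
    (c ⊙ f) w = c ℤ.* f w

    ε? : Coeffs
    ε? []      = 1ℤ
    ε? (_ ∷ _) = 0ℤ

    interchange : ∀ a b c d → (a ℤ.+ b) ℤ.+ (c ℤ.+ d) ≡ (a ℤ.+ c) ℤ.+ (b ℤ.+ d)
    interchange a b c d = begin
      (a ℤ.+ b) ℤ.+ (c ℤ.+ d)   ≡⟨ ℤₚ.+-assoc a b _ ⟩
      a ℤ.+ (b ℤ.+ (c ℤ.+ d))   ≡⟨ cong (λ t → a ℤ.+ t) (ℤₚ.+-assoc b c d) ⟨
      a ℤ.+ ((b ℤ.+ c) ℤ.+ d)   ≡⟨ cong (λ t → a ℤ.+ (t ℤ.+ d)) (ℤₚ.+-comm b c) ⟩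
      a ℤ.+ ((c ℤ.+ b) ℤ.+ d)   ≡⟨ cong (λ t → a ℤ.+ t) (ℤₚ.+-assoc c b d) ⟩
      a ℤ.+ (c ℤ.+ (b ℤ.+ d))   ≡⟨ ℤₚ.+-assoc a c _ ⟨
      (a ℤ.+ c) ℤ.+ (b ℤ.+ d)   ∎
      where open ≡-Reasoning

  conv-[] : (f g : List X → ℤ) → conv f g [] ≡ f [] ℤ.* g []
  conv-[] f g = ℤₚ.+-identityʳ _

  conv-∷ : (f g : List X → ℤ) (a : X) (w : List X) →
           conv f g (a ∷ w) ≡ f [] ℤ.* g (a ∷ w) ℤ.+ conv (f ∘ (a ∷_)) g w
  conv-∷ f g a w = cong (λ t → f [] ℤ.* g (a ∷ w) ℤ.+ sumℤ t) (sym (Listₚ.map-∘ (splits w)))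

  conv-cong : {f f′ g g′ : List X → ℤ} → f ≗ f′ → g ≗ g′ → conv f g ≗ conv f′ g′
  conv-cong p q w = cong sumℤ (Listₚ.map-cong (λ (x , y) → cong₂ ℤ._*_ (p x) (q y)) (splits w))

  private
    conv-0ˡ : {f : Coeffs} (g : Coeffs) → (∀ x → f x ≡ 0ℤ) → ∀ w → conv f g w ≡ 0ℤ
    conv-0ˡ {f} g z [] = trans (conv-[] f g) (cong (ℤ._* g []) (z []))
    conv-0ˡ {f} g z (a ∷ w) = trans (conv-∷ f g a w)
      (cong₂ ℤ._+_ (cong (ℤ._* g (a ∷ w)) (z [])) (conv-0ˡ g (z ∘ (a ∷_)) w))

    conv-bounded : ∀ (f g : Coeffs) M N →
                   (∀ x → M < length x → f x ≡ 0ℤ) → (∀ y → N < length y → g y ≡ 0ℤ) →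
                   ∀ w → M ℕ.+ N < length w → conv f g w ≡ 0ℤ
    conv-bounded f g zero N p q (a ∷ w) lt = trans (conv-∷ f g a w)
      (cong₂ ℤ._+_ (trans (cong (f [] ℤ.*_) (q (a ∷ w) lt)) (ℤₚ.*-zeroʳ (f [])))
                   (conv-0ˡ g (λ x → p (a ∷ x) (s≤s ℕ.z≤n)) w))
    conv-bounded f g (suc M) N p q (a ∷ w) lt = trans (conv-∷ f g a w)
      (cong₂ ℤ._+_ (trans (cong (f [] ℤ.*_) (q (a ∷ w) (ℕₚ.≤-<-trans (ℕₚ.m≤n+m N (suc M)) lt)))
                          (ℤₚ.*-zeroʳ (f [])))
                   (conv-bounded (f ∘ (a ∷_)) g M N (λ x → p (a ∷ x) ∘ s≤s) q w (ℕ.s≤s⁻¹ lt)))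

    conv-⊕ˡ : ∀ f f′ g → conv (f ⊕ f′) g ≗ conv f g ⊕ conv f′ g
    conv-⊕ˡ f f′ g [] = trans (conv-[] (f ⊕ f′) g)
      (trans (ℤₚ.*-distribʳ-+ (g []) (f []) (f′ []))
             (sym (cong₂ ℤ._+_ (conv-[] f g) (conv-[] f′ g))))
    conv-⊕ˡ f f′ g (a ∷ w) = trans (conv-∷ (f ⊕ f′) g a w)
      (trans (cong₂ ℤ._+_ (ℤₚ.*-distribʳ-+ (g (a ∷ w)) (f []) (f′ []))
                          (conv-⊕ˡ (f ∘ (a ∷_)) (f′ ∘ (a ∷_)) g w))
      (trans (interchange (f [] ℤ.* g (a ∷ w)) (f′ [] ℤ.* g (a ∷ w))
                          (conv (f ∘ (a ∷_)) g w) (conv (f′ ∘ (a ∷_)) g w))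
             (sym (cong₂ ℤ._+_ (conv-∷ f g a w) (conv-∷ f′ g a w)))))

    conv-⊕ʳ : ∀ f g g′ → conv f (g ⊕ g′) ≗ conv f g ⊕ conv f g′
    conv-⊕ʳ f g g′ [] = trans (conv-[] f (g ⊕ g′))
      (trans (ℤₚ.*-distribˡ-+ (f []) (g []) (g′ []))
             (sym (cong₂ ℤ._+_ (conv-[] f g) (conv-[] f g′))))
    conv-⊕ʳ f g g′ (a ∷ w) = trans (conv-∷ f (g ⊕ g′) a w)
      (trans (cong₂ ℤ._+_ (ℤₚ.*-distribˡ-+ (f []) (g (a ∷ w)) (g′ (a ∷ w)))
                          (conv-⊕ʳ (f ∘ (a ∷_)) g g′ w))
      (trans (interchange (f [] ℤ.* g (a ∷ w)) (f [] ℤ.* g′ (a ∷ w))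
                          (conv (f ∘ (a ∷_)) g w) (conv (f ∘ (a ∷_)) g′ w))
             (sym (cong₂ ℤ._+_ (conv-∷ f g a w) (conv-∷ f g′ a w)))))

    conv-⊙ : ∀ c f g → conv (c ⊙ f) g ≗ c ⊙ conv f g
    conv-⊙ c f g [] = trans (conv-[] (c ⊙ f) g)
      (trans (ℤₚ.*-assoc c (f []) (g [])) (cong (c ℤ.*_) (sym (conv-[] f g))))
    conv-⊙ c f g (a ∷ w) = trans (conv-∷ (c ⊙ f) g a w)
      (trans (cong₂ ℤ._+_ (ℤₚ.*-assoc c (f []) (g (a ∷ w))) (conv-⊙ c (f ∘ (a ∷_)) g w))
      (trans (sym (ℤₚ.*-distribˡ-+ c (f [] ℤ.* g (a ∷ w)) (conv (f ∘ (a ∷_)) g w))) (cong (c ℤ.*_) (sym (conv-∷ f g a w)))))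

    conv-assoc : ∀ f g h → conv (conv f g) h ≗ conv f (conv g h)
    conv-assoc f g h [] = begin
      conv (conv f g) h []          ≡⟨ conv-[] (conv f g) h ⟩
      conv f g [] ℤ.* h []          ≡⟨ cong (ℤ._* h []) (conv-[] f g) ⟩
      f [] ℤ.* g [] ℤ.* h []        ≡⟨ ℤₚ.*-assoc (f []) (g []) (h []) ⟩
      f [] ℤ.* (g [] ℤ.* h [])      ≡⟨ cong (f [] ℤ.*_) (conv-[] g h) ⟨
      f [] ℤ.* conv g h []          ≡⟨ conv-[] f (conv g h) ⟨
      conv f (conv g h) []          ∎
      where open ≡-Reasoning
    conv-assoc f g h (a ∷ w) = begin
      conv (conv f g) h (a ∷ w)
        ≡⟨ conv-∷ (conv f g) h a w ⟩
      conv f g [] ℤ.* h (a ∷ w) ℤ.+ conv (conv f g ∘ (a ∷_)) h w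
        ≡⟨ cong₂ ℤ._+_ (trans (cong (ℤ._* h (a ∷ w)) (conv-[] f g)) (ℤₚ.*-assoc (f []) (g []) (h (a ∷ w)))) tail ⟩
      f [] ℤ.* (g [] ℤ.* h (a ∷ w)) ℤ.+ (f [] ℤ.* conv (g ∘ (a ∷_)) h w ℤ.+ conv (f ∘ (a ∷_)) (conv g h) w)
        ≡⟨ ℤₚ.+-assoc (f [] ℤ.* (g [] ℤ.* h (a ∷ w))) (f [] ℤ.* conv (g ∘ (a ∷_)) h w) _ ⟨
      f [] ℤ.* (g [] ℤ.* h (a ∷ w)) ℤ.+ f [] ℤ.* conv (g ∘ (a ∷_)) h w ℤ.+ conv (f ∘ (a ∷_)) (conv g h) w
        ≡⟨ cong (λ t → t ℤ.+ conv (f ∘ (a ∷_)) (conv g h) w)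
             (ℤₚ.*-distribˡ-+ (f []) (g [] ℤ.* h (a ∷ w)) (conv (g ∘ (a ∷_)) h w)) ⟨
      f [] ℤ.* (g [] ℤ.* h (a ∷ w) ℤ.+ conv (g ∘ (a ∷_)) h w) ℤ.+ conv (f ∘ (a ∷_)) (conv g h) w
        ≡⟨ cong (λ t → f [] ℤ.* t ℤ.+ conv (f ∘ (a ∷_)) (conv g h) w) (conv-∷ g h a w) ⟨
      f [] ℤ.* conv g h (a ∷ w) ℤ.+ conv (f ∘ (a ∷_)) (conv g h) w
        ≡⟨ conv-∷ f (conv g h) a w ⟨
      conv f (conv g h) (a ∷ w) ∎
      where
      open ≡-Reasoning
      tail : conv (conv f g ∘ (a ∷_)) h w
             ≡ f [] ℤ.* conv (g ∘ (a ∷_)) h w ℤ.+ conv (f ∘ (a ∷_)) (conv g h) w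
      tail = trans (conv-cong {g = h} (conv-∷ f g a) (λ _ → refl) w)
        (trans (conv-⊕ˡ (f [] ⊙ (g ∘ (a ∷_))) (conv (f ∘ (a ∷_)) g) h w)
               (cong₂ ℤ._+_ (conv-⊙ (f []) (g ∘ (a ∷_)) h w) (conv-assoc (f ∘ (a ∷_)) g h w)))

    conv-identityˡ : ∀ f → conv ε? f ≗ f
    conv-identityˡ f [] = trans (conv-[] ε? f) (ℤₚ.*-identityˡ _)
    conv-identityˡ f (a ∷ w) = trans (conv-∷ ε? f a w)
      (trans (cong₂ ℤ._+_ (ℤₚ.*-identityˡ (f (a ∷ w))) (conv-0ˡ f (λ _ → refl) w))
             (ℤₚ.+-identityʳ _))

    conv-identityʳ : ∀ f → conv f ε? ≗ f
    conv-identityʳ f [] = trans (conv-[] f ε?) (ℤₚ.*-identityʳ _)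
    conv-identityʳ f (a ∷ w) = trans (conv-∷ f ε? a w)
      (trans (cong₂ ℤ._+_ (ℤₚ.*-zeroʳ (f [])) (conv-identityʳ (f ∘ (a ∷_)) w))
             (ℤₚ.+-identityˡ _))

  infix  4 _≋_
  infixl 6 _⊞_
  infixl 7 _⊠_
  infixr 7 _·_

  _≋_ : ℤ⟨ X ⟩ → ℤ⟨ X ⟩ → Set
  f ≋ g = ∀ w → coeff f w ≡ coeff g w

  _⊞_ : ℤ⟨ X ⟩ → ℤ⟨ X ⟩ → ℤ⟨ X ⟩
  mk f (M , p) ⊞ mk g (N , q) = mk (f ⊕ g) (M ⊔ N , λ w lt →
    cong₂ ℤ._+_ (p w (ℕₚ.≤-<-trans (ℕₚ.m≤m⊔n M N) lt)) (q w (ℕₚ.≤-<-trans (ℕₚ.m≤n⊔m M N) lt)))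

  _·_ : ℤ → ℤ⟨ X ⟩ → ℤ⟨ X ⟩
  c · mk f (N , p) = mk (c ⊙ f) (N , λ w lt → trans (cong (c ℤ.*_) (p w lt)) (ℤₚ.*-zeroʳ c))

  ⊟_ : ℤ⟨ X ⟩ → ℤ⟨ X ⟩
  ⊟ mk f (N , p) = mk (ℤ.-_ ∘ f) (N , λ w lt → cong ℤ.-_ (p w lt))

  _⊠_ : ℤ⟨ X ⟩ → ℤ⟨ X ⟩ → ℤ⟨ X ⟩
  mk f (M , p) ⊠ mk g (N , q) = mk (conv f g) (M ℕ.+ N , conv-bounded f g M N p q)

  𝟘 : ℤ⟨ X ⟩
  𝟘 = mk (λ _ → 0ℤ) (0 , λ _ _ → refl)

  -- The empty word.
  𝟙 : ℤ⟨ X ⟩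
  𝟙 = mk ε? (0 , λ { (_ ∷ _) _ → refl })

  ℤ⟨⟩-ring : Ring 0ℓ 0ℓ
  ℤ⟨⟩-ring = record
    { Carrier = ℤ⟨ X ⟩
    ; _≈_ = _≋_
    ; _+_ = _⊞_
    ; _*_ = _⊠_
    ; -_  = ⊟_
    ; 0#  = 𝟘
    ; 1#  = 𝟙
    ; isRing = record
      { +-isAbelianGroup = record
        { isGroup = record
          { isMonoid = record
            { isSemigroup = record
              { isMagma = record
                { isEquivalence = record
                  { refl  = λ _ → refl
                  ; sym   = λ p w → sym (p w)
                  ; trans = λ p q w → trans (p w) (q w)
                  }
                ; ∙-cong = λ p q w → cong₂ ℤ._+_ (p w) (q w)
                }
              ; assoc = λ f g h w → ℤₚ.+-assoc (coeff f w) (coeff g w) (coeff h w)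
              }
            ; identity = (λ f w → ℤₚ.+-identityˡ (coeff f w)) , (λ f w → ℤₚ.+-identityʳ (coeff f w))
            }
          ; inverse = (λ f w → ℤₚ.+-inverseˡ (coeff f w)) , (λ f w → ℤₚ.+-inverseʳ (coeff f w))
          ; ⁻¹-cong = λ p w → cong ℤ.-_ (p w)
          }
        ; comm = λ f g w → ℤₚ.+-comm (coeff f w) (coeff g w)
        }
      ; *-cong = λ p q → conv-cong p q
      ; *-assoc = λ f g h → conv-assoc (coeff f) (coeff g) (coeff h)
      ; *-identity = (λ f → conv-identityˡ (coeff f)) , (λ f → conv-identityʳ (coeff f))
      ; distrib = (λ f g h → conv-⊕ʳ (coeff f) (coeff g) (coeff h))
                , (λ f g h → conv-⊕ˡ (coeff g) (coeff h) (coeff f))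
      }
    }

  ∑ : {I : Set} → List I → (I → ℤ⟨ X ⟩) → ℤ⟨ X ⟩
  ∑ is f = foldr (λ i s → f i ⊞ s) 𝟘 is

  infix 2 ∑
  syntax ∑ is (λ i → e) = ∑[ i ∈ is ] e

  -- Membership in the ℤ-submodule of finite ℤ-linear combinations of a family.
  Span : {I : Set} → (I → ℤ⟨ X ⟩) → ℤ⟨ X ⟩ → Set
  Span {I} x f = ∃ λ (ts : List (ℤ × I)) → f ≋ ∑ ts (λ (c , i) → c · x i)

  record IsSubalgebra (S : ℤ⟨ X ⟩ → Set) : Set where
    field
      ≋-closed : ∀ {f g} → f ≋ g → S f → S g
      0-closed : S 𝟘
      +-closed : ∀ {f g} → S f → S g → S (f ⊞ g)
      ·-closed : ∀ {c f} → S f → S (c · f)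
      1-closed : S 𝟙
      *-closed : ∀ {f g} → S f → S g → S (f ⊠ g)

------------------------------------------------------------------------
-- Standardization.  The letter b ∈ B = {1 < 2 < 3 < ⋯} is encoded as b − 1 ∈ ℕ,
-- and likewise the elements of {1,…,n} as elements of Fin n.

B : Set
B = ℕ

module _ {n : ℕ} (v : Vec B n) where

  occurrences : B → List (Fin n)
  occurrences b = filter (λ i → Vec.lookup v i ℕₚ.≟ b) (allFin n)

  maxLetter : B
  maxLetter = Vec.foldr′ _⊔_ 0 v

  -- The positions in the order in which they are labelled 1, 2, …: those of the
  -- smallest letter from left to right, then those of the next smallest, and so
  -- on (letters that do not occur contribute nothing).
  scan : List (Fin n)
  scan = concatMap occurrences (upTo (suc maxLetter))

lookup≤max : ∀ {n} (v : Vec B n) i → Vec.lookup v i ≤ maxLetter v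
lookup≤max (b ∷ v) zero    = ℕₚ.m≤m⊔n b (maxLetter v)
lookup≤max (b ∷ v) (suc i) = ℕₚ.≤-trans (lookup≤max v i) (ℕₚ.m≤n⊔m b (maxLetter v))

private
  lookup-injective : {X : Set} {xs : List X} → Unique xs →
                     ∀ i j → List.lookup xs i ≡ List.lookup xs j → i ≡ j
  lookup-injective (_  ∷ _) zero    zero    _ = refl
  lookup-injective {xs = _ ∷ xs} (px ∷ _) zero (suc j) e =
    contradiction e (All.lookup px (∈-lookup {xs = xs} j))
  lookup-injective {xs = _ ∷ xs} (px ∷ _) (suc i) zero e =
    contradiction (sym e) (All.lookup px (∈-lookup {xs = xs} i))
  lookup-injective (_  ∷ u) (suc i) (suc j) e = cong suc (lookup-injective u i j e)

module _ {n : ℕ} (v : Vec B n) where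

  ∈-scan : ∀ i → i ∈ scan v
  ∈-scan i = ∈-concatMap⁺ (occurrences v)
    (Any.map (λ { refl → ∈-filter⁺ (λ j → Vec.lookup v j ℕₚ.≟ _) (∈-allFin i) refl })
             (∈-upTo⁺ (s≤s (lookup≤max v i))))

  scan-unique : Unique (scan v)
  scan-unique = Uniqueₚ.concat⁺
    (Allₚ.map⁺ (All.universal (λ b → Uniqueₚ.filter⁺ (λ i → Vec.lookup v i ℕₚ.≟ b) (Uniqueₚ.allFin⁺ n)) _))
    (AllPairsₚ.map⁺ (AllPairs.map disjoint (Uniqueₚ.upTo⁺ (suc (maxLetter v)))))
    where
    letter : ∀ {i b} → i ∈ occurrences v b → Vec.lookup v i ≡ b
    letter {b = b} p = proj₂ (∈-filter⁻ (λ i → Vec.lookup v i ℕₚ.≟ b) {xs = allFin n} p)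

    disjoint : ∀ {b c} → b ≢ c → ∀ {i} → ¬ (i ∈ occurrences v b × i ∈ occurrences v c)
    disjoint b≢c (p , q) = b≢c (trans (sym (letter p)) (letter q))

  scanned : Permutation (length (scan v)) n
  scanned = permutation (List.lookup (scan v)) (λ i → Any.index (∈-scan i))
    (λ i → sym (Anyₚ.lookup-index (∈-scan i)))
    (λ k → lookup-injective scan-unique _ k
             (sym (Anyₚ.lookup-index (∈-scan (List.lookup (scan v) k)))))

  -- Sends a position to its label.  The cast is along length (scan v) ≡ n.
  std : Permutation′ n
  std = flip scanned ∘ₚ cast-id (↔⇒≡ scanned)

------------------------------------------------------------------------
-- Permutations and their convolution

word : ∀ {n} → Permutation′ n → Vec B n
word σ = Vec.tabulate (λ i → toℕ (σ ⟨$⟩ʳ i))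

infix 4 _≟ₚ_
_≟ₚ_ : ∀ {n} → Decidable (Perm._≈_ {n} {n})
σ ≟ₚ τ = Finₚ.all? (λ i → σ ⟨$⟩ʳ i Finₚ.≟ τ ⟨$⟩ʳ i)

-- All of 𝔖ₙ: choose the image of the first point, then the rest.
permutations : ∀ n → List (Permutation′ n)
permutations zero    = Perm.id ∷ []
permutations (suc n) = concatMap (λ j → List.map (insert zero j) (permutations n)) (allFin (suc n))

private
  insert-suc : ∀ {n} j (π : Permutation′ n) k →
               insert zero j π ⟨$⟩ʳ suc k ≡ punchIn j (π ⟨$⟩ʳ k)
  insert-suc j π k = insert-punchIn zero j π k

  insert-zero : ∀ {n} j (π : Permutation′ n) → insert zero j π ⟨$⟩ʳ zero ≡ j
  insert-zero j π = refl

permutations-complete : ∀ {n} (σ : Permutation′ n) → Any (σ Perm.≈_) (permutations n)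
permutations-complete {zero}  σ = here (λ ())
permutations-complete {suc n} σ = Anyₚ.concatMap⁺ _
  (Any.map (λ { refl → Anyₚ.map⁺ (Any.map extend (permutations-complete (remove zero σ))) })
           (∈-allFin (σ ⟨$⟩ʳ zero)))
  where
  extend : ∀ {π} → remove zero σ Perm.≈ π → σ Perm.≈ insert zero (σ ⟨$⟩ʳ zero) π
  extend     eq zero    = refl
  extend {π} eq (suc k) = trans (sym (insert-remove zero σ (suc k)))
    (trans (insert-suc _ (remove zero σ) k)
    (trans (cong (punchIn _) (eq k)) (sym (insert-suc _ π k))))

permutations-distinct : ∀ n → AllPairs (λ σ τ → ¬ σ Perm.≈ τ) (permutations n)
permutations-distinct zero    = [] ∷ []
permutations-distinct (suc n) = AllPairsₚ.concat⁺
  (Allₚ.map⁺ (All.universal (λ j → AllPairsₚ.map⁺ (AllPairs.map (same j) (permutations-distinct n))) _))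
  (AllPairsₚ.map⁺ (AllPairs.map
    (λ j≢k → Allₚ.map⁺ (All.universal (λ σ → Allₚ.map⁺ (All.universal (λ τ eq → j≢k (eq zero)) _)) _))
    (Uniqueₚ.allFin⁺ (suc n))))
  where
  same : ∀ j {σ τ : Permutation′ n} → ¬ σ Perm.≈ τ → ¬ insert zero j σ Perm.≈ insert zero j τ
  same j {σ} {τ} σ≉τ eq = σ≉τ (λ k → Finₚ.punchIn-injective j _ _
    (trans (sym (insert-suc j σ k)) (trans (eq (suc k)) (insert-suc j τ k))))

module _ {p q : ℕ} (σ′ : Permutation′ p) (σ″ : Permutation′ q) where

  InConvolution : Permutation′ (p ℕ.+ q) → Set
  InConvolution τ = std (Vec.take p (word τ)) Perm.≈ σ′ × std (Vec.drop p (word τ)) Perm.≈ σ″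

  inConvolution? : ∀ τ → Dec (InConvolution τ)
  inConvolution? τ = (std (Vec.take p (word τ)) ≟ₚ σ′) ×-dec (std (Vec.drop p (word τ)) ≟ₚ σ″)

  convolution : List (Permutation′ (p ℕ.+ q))
  convolution = filter inConvolution? (permutations (p ℕ.+ q))

------------------------------------------------------------------------
-- Colored permutations and dual free l-quasi-ribbons

indicator : {P : Set} → Dec P → ℤ
indicator P? = if ⌊ P? ⌋ then 1ℤ else 0ℤ

private
  indicator-no : {P : Set} (P? : Dec P) → ¬ P → indicator P? ≡ 0ℤ
  indicator-no (yes p) ¬p = contradiction p ¬p
  indicator-no (no _)  ¬p = refl

module _ (l : ℕ) where

  C : Set
  C = Fin l

  A : Set
  A = B × C

  infix 4 _&_
  record ColoredPermutation : Set where
    constructor _&_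
    field
      {size} : ℕ
      perm   : Permutation′ size
      colors : Vec C size

module _ {l : ℕ} where

  data _≈ᶜ_ : ColoredPermutation l → ColoredPermutation l → Set where
    both : ∀ {n} {σ τ : Permutation′ n} {u t : Vec (C l) n} →
           σ Perm.≈ τ → u ≡ t → (σ & u) ≈ᶜ (τ & t)

  _≟ᶜ_ : Decidable _≈ᶜ_
  (_&_ {m} σ u) ≟ᶜ (_&_ {n} τ t) with m ℕₚ.≟ n
  ... | no  m≢n  = no λ { (both _ _) → m≢n refl }
  ... | yes refl = map′ (λ (p , q) → both p q) (λ { (both p q) → p , q })
                        ((σ ≟ₚ τ) ×-dec Vecₚ.≡-dec Finₚ._≟_ u t)

  Std : List (A l) → ColoredPermutation l
  Std w = std (Vec.map proj₁ (Vec.fromList w)) & Vec.map proj₂ (Vec.fromList w)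

  private
    ≈ᶜ⇒size≡ : ∀ {π ρ} → π ≈ᶜ ρ →
               ColoredPermutation.size π ≡ ColoredPermutation.size ρ
    ≈ᶜ⇒size≡ (both _ _) = refl

  𝐆 : ColoredPermutation l → ℤ⟨ A l ⟩
  𝐆 π = mk (λ w → indicator (Std w ≟ᶜ π))
           (ColoredPermutation.size π , λ w lt →
             indicator-no (Std w ≟ᶜ π) (λ eq → ℕₚ.<⇒≢ lt (sym (≈ᶜ⇒size≡ eq))))

{-# OPTIONS --safe #-}

-- Std(v) is the unique permutation σ such that σ(i) < σ(j) iff (v_i , i) precedes (v_j , j)
-- lexicographically. Restricting this to the first p or the last q positions of v shows that
-- v and Std(v) have prefixes (and suffixes) with the same standardization. Hence a word w of
-- length p + q is counted on the left, necessarily by its only splitting into lengths p and q,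
-- iff its colors are u′ · u″ and Std of its underlying word lies in σ′ * σ″, and then exactly
-- one term on the right counts it.

module Submission where

open import Defs
open import Data.Nat.Base using (ℕ; _≤_)
open import Data.Product.Base using (_×_; _,_)
open import Data.Vec.Base using (Vec; _++_)
open import Data.Fin.Permutation using (Permutation′)

open import Algebra.Bundles using (Ring)
open import Data.Fin.Base as Fin using (Fin; zero; suc; toℕ; inject₁; _↑ˡ_; _↑ʳ_)
open import Data.Fin.Permutation as Perm using (_⟨$⟩ʳ_; _⟨$⟩ˡ_)
import Data.Fin.Properties as Finₚ
open import Data.Integer.Base as ℤ using (ℤ; 0ℤ; 1ℤ)
import Data.Integer.Properties as ℤₚ
open import Data.List.Base as List using (List; []; _∷_; length; upTo; allFin)
open import Data.List.Membership.Propositional using (find; lose)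
open import Data.List.Membership.Propositional.Properties using (∈-filter⁺; ∈-filter⁻; ∈-lookup)
import Data.List.Properties as Listₚ
open import Data.List.Relation.Unary.All as All using (All; []; _∷_)
import Data.List.Relation.Unary.All.Properties as Allₚ
open import Data.List.Relation.Unary.AllPairs as AllPairs using (AllPairs; []; _∷_)
import Data.List.Relation.Unary.AllPairs.Properties as AllPairsₚ
open import Data.List.Relation.Unary.Any as Any using (Any; any?)
import Data.List.Relation.Unary.Any.Properties as Anyₚ
open import Data.Nat.Base using (zero; suc; _+_; _<_; z≤n; s<s⁻¹)
import Data.Nat.Properties as ℕₚ
open import Data.Product.Base using (∃; ∃₂; proj₁; proj₂)
open import Data.Sum.Base using (_⊎_; inj₁; inj₂)
open import Data.Vec.Base as Vec using ([]; _∷_; lookup; take; drop; map; toList; fromList)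
import Data.Vec.Properties as Vecₚ
open import Function.Base using (_∘_; id)
open import Function.Bundles using (Injection)
open import Function.Properties.Inverse using (↔⇒↣)
open import Relation.Binary.Definitions using (Tri; tri<; tri≈; tri>)
open import Relation.Binary.PropositionalEquality
open import Relation.Nullary using (Dec; yes; no; ¬_; contradiction)
open import Relation.Nullary.Decidable using (_×-dec_)

-- Spans and subalgebras

sumℤ-map-* : {I : Set} (c : ℤ) (h : I → ℤ) (is : List I) →
             sumℤ (List.map (λ i → c ℤ.* h i) is) ≡ c ℤ.* sumℤ (List.map h is)
sumℤ-map-* c h []       = sym (ℤₚ.*-zeroʳ c)
sumℤ-map-* c h (i ∷ is) = trans (cong (λ s → c ℤ.* h i ℤ.+ s) (sumℤ-map-* c h is))
                                (sym (ℤₚ.*-distribˡ-+ c (h i) _))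

module _ {X : Set} where

  ·-⊠-assoc : ∀ c (f g : ℤ⟨ X ⟩) → (c · f) ⊠ g ≋ c · (f ⊠ g)
  ·-⊠-assoc c f g w = trans
    (cong sumℤ (Listₚ.map-cong (λ (x , y) → ℤₚ.*-assoc c (coeff f x) (coeff g y)) (splits w)))
    (sumℤ-map-* c _ (splits w))

  ⊠-·-comm : ∀ c (f g : ℤ⟨ X ⟩) → f ⊠ (c · g) ≋ c · (f ⊠ g)
  ⊠-·-comm c f g w = trans
    (cong sumℤ (Listₚ.map-cong (λ (x , y) → swap (coeff f x) (coeff g y)) (splits w)))
    (sumℤ-map-* c _ (splits w))
    where
    swap : ∀ a b → a ℤ.* (c ℤ.* b) ≡ c ℤ.* (a ℤ.* b)
    swap a b = trans (sym (ℤₚ.*-assoc a c b))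
                     (trans (cong (ℤ._* b) (ℤₚ.*-comm a c)) (ℤₚ.*-assoc c a b))

  coeff-∑ : {I : Set} (is : List I) (f : I → ℤ⟨ X ⟩) (w : List X) →
            coeff (∑ is f) w ≡ sumℤ (List.map (λ i → coeff (f i) w) is)
  coeff-∑ []       f w = refl
  coeff-∑ (i ∷ is) f w = cong (λ s → coeff (f i) w ℤ.+ s) (coeff-∑ is f w)

module _ {X I : Set} (x : I → ℤ⟨ X ⟩) where

  private
    module R = Ring (ℤ⟨⟩-ring {X})

    combination : List (ℤ × I) → ℤ⟨ X ⟩
    combination ts = ∑ ts (λ (c , i) → c · x i)

  Span-resp-≋ : ∀ f g → f ≋ g → Span x f → Span x g
  Span-resp-≋ f g f≋g (ts , e) = ts , λ w → trans (sym (f≋g w)) (e w)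

  Span-⊞ : ∀ f g → Span x f → Span x g → Span x (f ⊞ g)
  Span-⊞ f g (ts , d) (us , e) = ts List.++ us , λ w →
    trans (cong₂ ℤ._+_ (d w) (e w)) (sym (combination-++ ts w))
    where
    combination-++ : ∀ ts → combination (ts List.++ us) ≋ combination ts ⊞ combination us
    combination-++ []             w = sym (ℤₚ.+-identityˡ _)
    combination-++ ((c , i) ∷ ts) w =
      trans (cong (λ s → coeff (c · x i) w ℤ.+ s) (combination-++ ts w))
            (sym (ℤₚ.+-assoc (coeff (c · x i) w) (coeff (combination ts) w) _))

  Span-· : ∀ c f → Span x f → Span x (c · f)
  Span-· c f (ts , e) = List.map scale ts , λ w → trans (cong (c ℤ.*_) (e w)) (scaled ts w)
    where
    scale : ℤ × I → ℤ × I
    scale (d , i) = c ℤ.* d , i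

    scaled : ∀ ts → c · combination ts ≋ combination (List.map scale ts)
    scaled []             w = ℤₚ.*-zeroʳ c
    scaled ((d , i) ∷ ts) w =
      trans (ℤₚ.*-distribˡ-+ c (coeff (d · x i) w) _)
            (cong₂ ℤ._+_ (sym (ℤₚ.*-assoc c d (coeff (x i) w))) (scaled ts w))

  Span-∑ : {J : Set} (g : J → I) (js : List J) → Span x (∑[ j ∈ js ] x (g j))
  Span-∑ g js = List.map (λ j → 1ℤ , g j) js , unit js
    where
    unit : ∀ js → (∑[ j ∈ js ] x (g j)) ≋ combination (List.map (λ j → 1ℤ , g j) js)
    unit []       w = refl
    unit (j ∷ js) w = cong₂ ℤ._+_ (sym (ℤₚ.*-identityˡ (coeff (x (g j)) w))) (unit js w)

  -- Expanding `f` as a finite combination and distributing over `g` leaves scalar multiples of the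
  -- products `x i ⊠ g`, one for each term of the list.
  Span-⊠ˡ : ∀ f g → (∀ i → Span x (x i ⊠ g)) → Span x f → Span x (f ⊠ g)
  Span-⊠ˡ f g xg (ts , e) =
    Span-resp-≋ (combination ts ⊠ g) (f ⊠ g)
      (λ w → conv-cong {g = coeff g} (λ v → sym (e v)) (λ _ → refl) w) (go ts)
    where
    go : ∀ ts → Span x (combination ts ⊠ g)
    go []             = [] , R.zeroˡ g
    go ((c , i) ∷ ts) =
      Span-resp-≋ (c · (x i ⊠ g) ⊞ combination ts ⊠ g) (combination ((c , i) ∷ ts) ⊠ g)
        (λ w → sym (trans (R.distribʳ g (c · x i) (combination ts) w)
                          (cong (ℤ._+ _) (·-⊠-assoc c (x i) g w))))
        (Span-⊞ (c · (x i ⊠ g)) (combination ts ⊠ g) (Span-· c (x i ⊠ g) (xg i)) (go ts))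

  Span-⊠ʳ : ∀ f g → (∀ i → Span x (f ⊠ x i)) → Span x g → Span x (f ⊠ g)
  Span-⊠ʳ f g fx (ts , e) =
    Span-resp-≋ (f ⊠ combination ts) (f ⊠ g)
      (λ w → conv-cong {f = coeff f} (λ _ → refl) (λ v → sym (e v)) w) (go ts)
    where
    go : ∀ ts → Span x (f ⊠ combination ts)
    go []             = [] , R.zeroʳ f
    go ((c , i) ∷ ts) =
      Span-resp-≋ (c · (f ⊠ x i) ⊞ f ⊠ combination ts) (f ⊠ combination ((c , i) ∷ ts))
        (λ w → sym (trans (R.distribˡ f (c · x i) (combination ts) w)
                          (cong (ℤ._+ _) (⊠-·-comm c f (x i) w))))
        (Span-⊞ (c · (f ⊠ x i)) (f ⊠ combination ts) (Span-· c (f ⊠ x i) (fx i)) (go ts))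

  Span-isSubalgebra : Span x 𝟙 → (∀ i j → Span x (x i ⊠ x j)) → IsSubalgebra (Span x)
  Span-isSubalgebra one product = record
    { ≋-closed = λ {f} {g} → Span-resp-≋ f g
    ; 0-closed = [] , λ _ → refl
    ; +-closed = λ {f} {g} → Span-⊞ f g
    ; ·-closed = λ {c} {f} → Span-· c f
    ; 1-closed = one
    ; *-closed = λ {f} {g} f∈ g∈ →
        -- Bilinearity in two stages: `f` is expanded with `g` fixed, then `g` with each generator
        -- `x i` fixed, which leaves only products of two generators.
        Span-⊠ˡ f g (λ i → Span-⊠ʳ (x i) g (product i) g∈) f∈
    }

-- Standardization as an order isomorphism

AllPairs-lookup : ∀ {X : Set} {R : X → X → Set} {xs} → AllPairs R xs →
                  ∀ {i j} → i Fin.< j → R (List.lookup xs i) (List.lookup xs j)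
AllPairs-lookup {xs = _ ∷ xs} (px ∷ _)  {zero}  {suc j} _   = All.lookup px (∈-lookup {xs = xs} j)
AllPairs-lookup               (_ ∷ pxs) {suc i} {suc j} i<j = AllPairs-lookup pxs (s<s⁻¹ i<j)

-- Used inside a block of equal letters: the comparison of two positions there also needs to know
-- which letter each of them carries.
AllPairs-restrict : ∀ {X : Set} {P : X → Set} {R : X → X → Set} {xs} → All P xs → AllPairs R xs →
                    AllPairs (λ x y → P x × P y × R x y) xs
AllPairs-restrict []       []       = []
AllPairs-restrict (p ∷ ps) (r ∷ rs) =
  All.zipWith (λ (q , s) → p , q , s) (ps , r) ∷ AllPairs-restrict ps rs

module _ {n : ℕ} (v : Vec B n) where

  LexLess : Fin n → Fin n → Set
  LexLess i j = lookup v i < lookup v j ⊎ (lookup v i ≡ lookup v j × i Fin.< j)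

  LexLess-irrefl : ∀ {i} → ¬ LexLess i i
  LexLess-irrefl (inj₁ lt)       = ℕₚ.<-irrefl refl lt
  LexLess-irrefl (inj₂ (_ , lt)) = ℕₚ.<-irrefl refl lt

  LexLess-asym : ∀ {i j} → LexLess i j → ¬ LexLess j i
  LexLess-asym (inj₁ lt)       (inj₁ gt)       = ℕₚ.<-asym lt gt
  LexLess-asym (inj₁ lt)       (inj₂ (e , _))  = ℕₚ.<-irrefl (sym e) lt
  LexLess-asym (inj₂ (e , _))  (inj₁ gt)       = ℕₚ.<-irrefl (sym e) gt
  LexLess-asym (inj₂ (_ , lt)) (inj₂ (_ , gt)) = ℕₚ.<-asym lt gt

  -- Within a block the letters agree and filtering keeps the increasing order of `allFin n`;
  -- between blocks the letters increase because `upTo` does.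
  scan-sorted : AllPairs LexLess (scan v)
  scan-sorted = AllPairsₚ.concat⁺
    (Allₚ.map⁺ (All.universal within (upTo (suc (maxLetter v)))))
    (AllPairsₚ.map⁺ (AllPairs.map across
      (AllPairsₚ.applyUpTo⁺₁ (λ b → b) (suc (maxLetter v)) (λ b<c _ → b<c))))
    where
    letter : ∀ b → All (λ i → lookup v i ≡ b) (occurrences v b)
    letter b = Allₚ.all-filter (λ i → lookup v i ℕₚ.≟ b) (allFin n)

    within : ∀ b → AllPairs LexLess (occurrences v b)
    within b = AllPairs.map (λ (d , e , i<j) → inj₂ (trans d (sym e) , i<j))
      (AllPairs-restrict (letter b)
        (AllPairsₚ.filter⁺ (λ i → lookup v i ℕₚ.≟ b) (AllPairsₚ.tabulate⁺-< (λ i<j → i<j))))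

    across : ∀ {b c} → b < c → All (λ i → All (LexLess i) (occurrences v c)) (occurrences v b)
    across {b} {c} b<c = All.map (λ d → All.map (λ e → inj₁ (subst₂ _<_ (sym d) (sym e) b<c))
                                                (letter c))
                                 (letter b)

  -- The label of a position is its index in `scan v`, so the sortedness of that list compares the
  -- positions themselves.
  std-reflects : ∀ {i j} → std v ⟨$⟩ʳ i Fin.< std v ⟨$⟩ʳ j → LexLess i j
  std-reflects {i} {j} lt = subst₂ LexLess
    (sym (Anyₚ.lookup-index (∈-scan v i))) (sym (Anyₚ.lookup-index (∈-scan v j)))
    -- `Finₚ.toℕ-cast` removes the cast along `length (scan v) ≡ n`, which does not change the
    -- number.
    (AllPairs-lookup scan-sorted (subst₂ _<_ (Finₚ.toℕ-cast _ _) (Finₚ.toℕ-cast _ _) lt))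

  -- Of the other two outcomes of comparing the labels, equality is excluded by injectivity of
  -- `std v` and the reversed order by `std-reflects` with asymmetry.
  std-mono : ∀ {i j} → LexLess i j → std v ⟨$⟩ʳ i Fin.< std v ⟨$⟩ʳ j
  std-mono {i} {j} i<j = byTrichotomy (Finₚ.<-cmp (std v ⟨$⟩ʳ i) (std v ⟨$⟩ʳ j))
    where
    byTrichotomy : Tri (std v ⟨$⟩ʳ i Fin.< std v ⟨$⟩ʳ j) (std v ⟨$⟩ʳ i ≡ std v ⟨$⟩ʳ j)
                       (std v ⟨$⟩ʳ j Fin.< std v ⟨$⟩ʳ i) → std v ⟨$⟩ʳ i Fin.< std v ⟨$⟩ʳ j
    byTrichotomy (tri< lt _ _) = lt
    byTrichotomy (tri≈ _ eq _) = contradiction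
      (subst (LexLess i) (sym (Injection.injective (↔⇒↣ (std v)) eq)) i<j) LexLess-irrefl
    byTrichotomy (tri> _ _ gt) = contradiction (std-reflects gt) (LexLess-asym i<j)

strictMono⇒≤ : ∀ {n} (f : Fin n → ℕ) → (∀ {i j} → i Fin.< j → f i < f j) → ∀ i → toℕ i ≤ f i
strictMono⇒≤ f mono zero    = z≤n
strictMono⇒≤ f mono (suc i) = ℕₚ.≤-<-trans
  -- Restriction along `inject₁` gives `toℕ i ≤ f (inject₁ i)`; strictness from `inject₁ i` to
  -- `suc i` then supplies the missing one.
  (strictMono⇒≤ (f ∘ inject₁)
    (λ lt → mono (subst₂ _<_ (sym (Finₚ.toℕ-inject₁ _)) (sym (Finₚ.toℕ-inject₁ _)) lt)) i)
  (mono (ℕₚ.≤-reflexive (cong suc (Finₚ.toℕ-inject₁ i))))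

module _ {n : ℕ} where

  OrderEmbeds : Permutation′ n → Permutation′ n → Set
  OrderEmbeds σ τ = ∀ i j → σ ⟨$⟩ʳ i Fin.< σ ⟨$⟩ʳ j → τ ⟨$⟩ʳ i Fin.< τ ⟨$⟩ʳ j

  -- The map `k ↦ τ (σ⁻¹ k)` is strictly increasing, hence at least `k` everywhere; the bound is
  -- read off at `k = σ i`.
  OrderEmbeds⇒≤ : ∀ σ τ → OrderEmbeds σ τ → ∀ i → σ ⟨$⟩ʳ i Fin.≤ τ ⟨$⟩ʳ i
  OrderEmbeds⇒≤ σ τ σ⊑τ i =
    subst (λ k → σ ⟨$⟩ʳ i Fin.≤ τ ⟨$⟩ʳ k) (Perm.inverseˡ σ)
      (strictMono⇒≤ (λ k → toℕ (τ ⟨$⟩ʳ (σ ⟨$⟩ˡ k)))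
        (λ lt → σ⊑τ _ _ (subst₂ Fin._<_ (sym (Perm.inverseʳ σ)) (sym (Perm.inverseʳ σ)) lt))
        (σ ⟨$⟩ʳ i))

  OrderEmbeds-sym : ∀ σ τ → OrderEmbeds σ τ → OrderEmbeds τ σ
  OrderEmbeds-sym σ τ σ⊑τ i j lt with Finₚ.<-cmp (σ ⟨$⟩ʳ i) (σ ⟨$⟩ʳ j)
  ... | tri< σlt _ _ = σlt
  ... | tri≈ _ eq _  = contradiction lt (ℕₚ.<-irrefl (cong (λ k → toℕ (τ ⟨$⟩ʳ k)) (Injection.injective (↔⇒↣ σ) eq)))
  ... | tri> _ _ σgt = contradiction (σ⊑τ j i σgt) (ℕₚ.<-asym lt)

  -- A permutation is determined by the relative order of its values. One implication suffices
  -- because, the order being total, it yields its own converse.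
  OrderEmbeds⇒≈ : ∀ σ τ → OrderEmbeds σ τ → σ Perm.≈ τ
  OrderEmbeds⇒≈ σ τ σ⊑τ i = Finₚ.toℕ-injective (ℕₚ.≤-antisym
    (OrderEmbeds⇒≤ σ τ σ⊑τ i) (OrderEmbeds⇒≤ τ σ (OrderEmbeds-sym σ τ σ⊑τ) i))

-- Here `a` and `b` are read at the same positions `f`, one from `v` and one from its labels. An
-- increasing `f` preserves the breaking of ties by position, so the order on `a` passes to `v`;
-- `std v` then turns it into a strict inequality between letters of `b`.
std-subword : ∀ {m n} (v : Vec B n) (a b : Vec B m) (f : Fin m → Fin n) →
              (∀ {i j} → i Fin.< j → f i Fin.< f j) →
              (∀ i → lookup a i ≡ lookup v (f i)) →
              (∀ i → lookup b i ≡ toℕ (std v ⟨$⟩ʳ f i)) →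
              std a Perm.≈ std b
std-subword v a b f mono av bv = OrderEmbeds⇒≈ (std a) (std b) λ i j lt →
  std-mono b (inj₁ (subst₂ _<_ (sym (bv i)) (sym (bv j)) (std-mono v (transport (std-reflects a lt)))))
  where
  transport : ∀ {i j} → LexLess a i j → LexLess v (f i) (f j)
  transport (inj₁ lt)       = inj₁ (subst₂ _<_ (av _) (av _) lt)
  transport (inj₂ (e , lt)) = inj₂ (trans (sym (av _)) (trans e (av _)) , mono lt)

-- Prefixes, suffixes and membership in the convolution

lookup-take : ∀ {X : Set} p {q} (xs : Vec X (p + q)) i → lookup (take p xs) i ≡ lookup xs (i ↑ˡ q)
lookup-take p xs i = trans (sym (Vecₚ.lookup-++ˡ (take p xs) (drop p xs) i))
                           (cong (λ ys → lookup ys (i ↑ˡ _)) (Vecₚ.take++drop≡id p xs))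

lookup-drop : ∀ {X : Set} p {q} (xs : Vec X (p + q)) i → lookup (drop p xs) i ≡ lookup xs (p ↑ʳ i)
lookup-drop p xs i = trans (sym (Vecₚ.lookup-++ʳ (take p xs) (drop p xs) i))
                           (cong (λ ys → lookup ys (p ↑ʳ i)) (Vecₚ.take++drop≡id p xs))

module _ {p q : ℕ} (a : Vec B p) (b : Vec B q) where

  std-take : std a Perm.≈ std (take p (word (std (a ++ b))))
  std-take = std-subword (a ++ b) a (take p (word (std (a ++ b)))) (_↑ˡ q)
    (subst₂ _<_ (sym (Finₚ.toℕ-↑ˡ _ q)) (sym (Finₚ.toℕ-↑ˡ _ q)))
    (λ i → sym (Vecₚ.lookup-++ˡ a b i))
    (λ i → trans (lookup-take p (word (std (a ++ b))) i)
                 (Vecₚ.lookup∘tabulate (λ k → toℕ (std (a ++ b) ⟨$⟩ʳ k)) (i ↑ˡ q)))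

  std-drop : std b Perm.≈ std (drop p (word (std (a ++ b))))
  std-drop = std-subword (a ++ b) b (drop p (word (std (a ++ b)))) (p ↑ʳ_)
    (λ lt → subst₂ _<_ (sym (Finₚ.toℕ-↑ʳ p _)) (sym (Finₚ.toℕ-↑ʳ p _)) (ℕₚ.+-monoʳ-< p lt))
    (λ i → sym (Vecₚ.lookup-++ʳ a b i))
    (λ i → trans (lookup-drop p (word (std (a ++ b))) i)
                 (Vecₚ.lookup∘tabulate (λ k → toℕ (std (a ++ b) ⟨$⟩ʳ k)) (p ↑ʳ i)))

  inConvolution-std⁺ : ∀ {σ′ σ″} → std a Perm.≈ σ′ → std b Perm.≈ σ″ → InConvolution σ′ σ″ (std (a ++ b))
  inConvolution-std⁺ a≈ b≈ = (λ i → trans (sym (std-take i)) (a≈ i)) , (λ i → trans (sym (std-drop i)) (b≈ i))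

  inConvolution-std⁻ : ∀ {σ′ σ″} → InConvolution σ′ σ″ (std (a ++ b)) → std a Perm.≈ σ′ × std b Perm.≈ σ″
  inConvolution-std⁻ (a≈ , b≈) = (λ i → trans (std-take i) (a≈ i)) , (λ i → trans (std-drop i) (b≈ i))

module _ {p q : ℕ} (σ′ : Permutation′ p) (σ″ : Permutation′ q) where

  -- Membership depends on a permutation only through its `word`, and pointwise equal permutations
  -- have propositionally equal words.
  inConvolution-resp-≈ : ∀ ρ τ → ρ Perm.≈ τ → InConvolution σ′ σ″ ρ → InConvolution σ′ σ″ τ
  inConvolution-resp-≈ ρ τ ρ≈τ =
    subst (λ v → std (take p v) Perm.≈ σ′ × std (drop p v) Perm.≈ σ″)
          (Vecₚ.tabulate-cong (λ i → cong toℕ (ρ≈τ i)))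

  -- The enumeration of permutations contains `ρ` only up to `Perm.≈`, so membership is first moved
  -- to its representative `π`, which then passes the filter.
  convolution⁺ : ∀ ρ → InConvolution σ′ σ″ ρ → Any (ρ Perm.≈_) (convolution σ′ σ″)
  convolution⁺ ρ ρ∈ = let π , π∈ , ρ≈π = find (permutations-complete ρ) in
    lose (∈-filter⁺ (inConvolution? σ′ σ″) π∈ (inConvolution-resp-≈ ρ π ρ≈π ρ∈)) ρ≈π

  convolution⁻ : ∀ ρ → Any (ρ Perm.≈_) (convolution σ′ σ″) → InConvolution σ′ σ″ ρ
  convolution⁻ ρ any = let π , π∈ , ρ≈π = find any in
    inConvolution-resp-≈ π ρ (λ i → sym (ρ≈π i))
      (proj₂ (∈-filter⁻ (inConvolution? σ′ σ″) {xs = permutations (p + q)} π∈))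

-- Colored words

module _ {l : ℕ} where

  ≈ᶜ⇒size≡ : {π ρ : ColoredPermutation l} → π ≈ᶜ ρ →
             ColoredPermutation.size π ≡ ColoredPermutation.size ρ
  ≈ᶜ⇒size≡ (both _ _) = refl

  -- Applied with `π = Std w`, this shows that a word cannot be counted by two inequivalent terms of
  -- the sum.
  ≈ᶜ⇒≈ : ∀ {n} {π : ColoredPermutation l} {σ τ : Permutation′ n} {u t : Vec (C l) n} →
         π ≈ᶜ (σ & u) → π ≈ᶜ (τ & t) → σ Perm.≈ τ
  ≈ᶜ⇒≈ (both p _) (both q _) i = trans (sym (p i)) (q i)

  both⁻ : ∀ {n} (σ τ : Permutation′ n) (u t : Vec (C l) n) → (σ & u) ≈ᶜ (τ & t) → σ Perm.≈ τ × u ≡ t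
  both⁻ σ τ u t (both σ≈τ u≡t) = σ≈τ , u≡t

  Any-both⁻ : ∀ {n} (σ : Permutation′ n) (u t : Vec (C l) n) (τs : List (Permutation′ n)) →
              Any (λ τ → (σ & u) ≈ᶜ (τ & t)) τs → Any (σ Perm.≈_) τs × u ≡ t
  Any-both⁻ σ u t τs any =
    let τ , τ∈ , eq = find any
        σ≈τ , u≡t   = both⁻ σ τ u t eq
    in lose τ∈ σ≈τ , u≡t

  Stdᵛ : ∀ {n} → Vec (A l) n → ColoredPermutation l
  Stdᵛ v = std (map proj₁ v) & map proj₂ v

  Stdᵛ≡ : ∀ {n} (w : Vec (A l) n) {v : Vec B n} {u : Vec (C l) n} →
          map proj₁ w ≡ v → map proj₂ w ≡ u → Stdᵛ w ≡ (std v & u)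
  Stdᵛ≡ w refl refl = refl

  Std-toList : ∀ {n} (v : Vec (A l) n) → Std (toList v) ≡ Stdᵛ v
  Std-toList v = cong (λ (_ , t) → Stdᵛ t) (fromList-toList v)
    where
    -- The two vectors have lengths `length (toList v)` and `n`, so the equation is stated between
    -- pairs of a length and a vector.
    fromList-toList : ∀ {n} (v : Vec (A l) n) →
                      _≡_ {A = ∃ (Vec (A l))} (_ , fromList (toList v)) (n , v)
    fromList-toList []      = refl
    fromList-toList (a ∷ v) = cong (λ (_ , t) → _ , a ∷ t) (fromList-toList v)

  Std≡Stdᵛ : ∀ {n} (w : List (A l)) (v : Vec (A l) n) → w ≡ toList v → Std w ≡ Stdᵛ v
  Std≡Stdᵛ _ v refl = Std-toList v

-- Factoring a colored word into lengths `p` and `q`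

take-toList : ∀ {X : Set} {p q} (x : Vec X p) (y : Vec X q) → List.take p (toList (x ++ y)) ≡ toList x
take-toList []      y = refl
take-toList (a ∷ x) y = cong (a ∷_) (take-toList x y)

drop-toList : ∀ {X : Set} {p q} (x : Vec X p) (y : Vec X q) → List.drop p (toList (x ++ y)) ≡ toList y
drop-toList []      y = refl
drop-toList (_ ∷ x) y = drop-toList x y

splitWord : ∀ {X : Set} p {q} (w : List X) → length w ≡ p + q →
            ∃₂ λ (x : Vec X p) (y : Vec X q) → toList (x ++ y) ≡ w
splitWord p w eq = take p v , drop p v , (begin
  toList (take p v ++ drop p v)     ≡⟨ cong toList (Vecₚ.take++drop≡id p v) ⟩
  toList (Vec.cast eq (fromList w)) ≡⟨ Vecₚ.toList-cast eq (fromList w) ⟩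
  toList (fromList w)               ≡⟨ Vecₚ.toList∘fromList w ⟩
  w                                 ∎)
  where
  open ≡-Reasoning
  v = Vec.cast eq (fromList w)

module _ {l p q : ℕ} (σ′ : Permutation′ p) (u′ : Vec (C l) p) (σ″ : Permutation′ q) (u″ : Vec (C l) q) where

  -- This is the condition for `w` to be counted in the product. A word with fewer than `p` letters
  -- fails it, since `≈ᶜ` forces equal sizes and `List.take p w` is then too short.
  FactorsStd : List (A l) → Set
  FactorsStd w = Std (List.take p w) ≈ᶜ (σ′ & u′) × Std (List.drop p w) ≈ᶜ (σ″ & u″)

  ConvolutionStd : List (A l) → Set
  ConvolutionStd w = Any (λ σ → Std w ≈ᶜ (σ & u′ ++ u″)) (convolution σ′ σ″)

  module _ (x : Vec (A l) p) (y : Vec (A l) q) where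

    private
      Stdᵛ-++ : Stdᵛ (x ++ y) ≡ (std (map proj₁ x ++ map proj₁ y) & map proj₂ x ++ map proj₂ y)
      Stdᵛ-++ = Stdᵛ≡ (x ++ y) {map proj₁ x ++ map proj₁ y} {map proj₂ x ++ map proj₂ y}
                  (Vecₚ.map-++ proj₁ x y) (Vecₚ.map-++ proj₂ x y)

      InConvolutionᶜ : ColoredPermutation l → Set
      InConvolutionᶜ π = Any (λ σ → π ≈ᶜ (σ & u′ ++ u″)) (convolution σ′ σ″)

    factors⇒convolutionᵛ : Stdᵛ x ≈ᶜ (σ′ & u′) → Stdᵛ y ≈ᶜ (σ″ & u″) → InConvolutionᶜ (Stdᵛ (x ++ y))
    factors⇒convolutionᵛ d′ d″ =
      let a≈ , s′ = both⁻ (std (map proj₁ x)) σ′ (map proj₂ x) u′ d′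
          b≈ , s″ = both⁻ (std (map proj₁ y)) σ″ (map proj₂ y) u″ d″
      in subst InConvolutionᶜ (sym Stdᵛ-++) (Any.map (λ eq → both eq (cong₂ _++_ s′ s″))
           (convolution⁺ σ′ σ″ (std (map proj₁ x ++ map proj₁ y))
             (inConvolution-std⁺ (map proj₁ x) (map proj₁ y) {σ′} {σ″} a≈ b≈)))

    convolution⇒factorsᵛ : InConvolutionᶜ (Stdᵛ (x ++ y)) → Stdᵛ x ≈ᶜ (σ′ & u′) × Stdᵛ y ≈ᶜ (σ″ & u″)
    convolution⇒factorsᵛ any =
      let std∈ , s = Any-both⁻ (std (map proj₁ x ++ map proj₁ y)) (map proj₂ x ++ map proj₂ y) (u′ ++ u″)
                               (convolution σ′ σ″) (subst InConvolutionᶜ Stdᵛ-++ any)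
          a≈ , b≈  = inConvolution-std⁻ (map proj₁ x) (map proj₁ y) {σ′} {σ″}
                       (convolution⁻ σ′ σ″ (std (map proj₁ x ++ map proj₁ y)) std∈)
          s′ , s″  = Vecₚ.++-injective (map proj₂ x) u′ s
      in both a≈ s′ , both b≈ s″

    -- An equation between types, so that one proof transports evidence from lists to vectors and
    -- back.
    factorsStd≡ : FactorsStd (toList (x ++ y)) ≡ (Stdᵛ x ≈ᶜ (σ′ & u′) × Stdᵛ y ≈ᶜ (σ″ & u″))
    factorsStd≡ = cong₂ (λ π ρ → π ≈ᶜ (σ′ & u′) × ρ ≈ᶜ (σ″ & u″))
      {x = Std (List.take p (toList (x ++ y)))} {y = Stdᵛ x}
      {u = Std (List.drop p (toList (x ++ y)))} {v = Stdᵛ y}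
      (Std≡Stdᵛ (List.take p (toList (x ++ y))) x (take-toList x y))
      (Std≡Stdᵛ (List.drop p (toList (x ++ y))) y (drop-toList x y))

    convolutionStd≡ : ConvolutionStd (toList (x ++ y)) ≡
                      Any (λ σ → Stdᵛ (x ++ y) ≈ᶜ (σ & u′ ++ u″)) (convolution σ′ σ″)
    convolutionStd≡ = cong (λ π → Any (λ σ → π ≈ᶜ (σ & u′ ++ u″)) (convolution σ′ σ″)) (Std-toList (x ++ y))

  factors⇒convolution : ∀ w → FactorsStd w → ConvolutionStd w
  factors⇒convolution w fs@(e′ , e″) =
    let x , y , eq = splitWord p {q} w
          -- The length of `w` is recovered from the sizes `p` and `q` of the two matched
          -- standardizations.
          (trans (cong length (sym (Listₚ.take++drop≡id p w)))
          (trans (Listₚ.length-++ (List.take p w))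
                 (cong₂ _+_ (≈ᶜ⇒size≡ e′) (≈ᶜ⇒size≡ e″))))
        d′ , d″ = subst id (factorsStd≡ x y) (subst FactorsStd (sym eq) fs)
    in subst ConvolutionStd eq
         (subst id (sym (convolutionStd≡ x y)) (factors⇒convolutionᵛ x y d′ d″))

  convolution⇒factors : ∀ w → ConvolutionStd w → FactorsStd w
  convolution⇒factors w any =
    let x , y , eq = splitWord p {q} w (≈ᶜ⇒size≡ (proj₂ (proj₂ (find any))))
    in subst FactorsStd eq (subst id (sym (factorsStd≡ x y))
         (convolution⇒factorsᵛ x y (subst id (convolutionStd≡ x y) (subst ConvolutionStd (sym eq) any))))

-- Coefficients

indicator-no : {P : Set} (P? : Dec P) → ¬ P → indicator P? ≡ 0ℤ
indicator-no (yes p) ¬p = contradiction p ¬p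
indicator-no (no _)  _  = refl

indicator-cong : {P Q : Set} → (P → Q) → (Q → P) → (P? : Dec P) (Q? : Dec Q) → indicator P? ≡ indicator Q?
indicator-cong f g (yes p) (yes q) = refl
indicator-cong f g (yes p) (no ¬q) = contradiction (f p) ¬q
indicator-cong f g (no ¬p) (yes q) = contradiction (g q) ¬p
indicator-cong f g (no ¬p) (no ¬q) = refl

indicator-× : {P Q : Set} (P? : Dec P) (Q? : Dec Q) → indicator (P? ×-dec Q?) ≡ indicator P? ℤ.* indicator Q?
indicator-× (yes _) (yes _) = refl
indicator-× (yes _) (no _)  = refl
indicator-× (no _)  (yes _) = refl
indicator-× (no _)  (no _)  = refl

-- Pairwise exclusion allows at most one summand equal to 1, so the sum only records whether some
-- summand is.
sum-indicator : {I : Set} {P : I → Set} (P? : ∀ i → Dec (P i)) {is : List I} →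
                AllPairs (λ i j → ¬ (P i × P j)) is →
                sumℤ (List.map (λ i → indicator (P? i)) is) ≡ indicator (any? P? is)
sum-indicator P? [] = refl
-- The induction hypothesis is abstracted together with `any? P? is`, so each case also evaluates
-- its right-hand side.
sum-indicator P? {i ∷ is} (disjoint ∷ rest) with P? i | any? P? is | sum-indicator P? rest
... | yes p | yes ps | _  = let _ , j∈ , pj = find ps in contradiction (p , pj) (All.lookup disjoint j∈)
... | yes _ | no _   | ih = cong (λ s → 1ℤ ℤ.+ s) ih
... | no _  | yes _  | ih = cong (λ s → 0ℤ ℤ.+ s) ih
... | no _  | no _   | ih = cong (λ s → 0ℤ ℤ.+ s) ih

module _ {X : Set} where

  conv-zeroˡ : (f g : List X → ℤ) → (∀ x → f x ≡ 0ℤ) → ∀ w → conv f g w ≡ 0ℤ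
  conv-zeroˡ f g z []      = trans (conv-[] f g) (cong (ℤ._* g []) (z []))
  conv-zeroˡ f g z (a ∷ w) = trans (conv-∷ f g a w)
    (cong₂ ℤ._+_ (cong (ℤ._* g (a ∷ w)) (z [])) (conv-zeroˡ (f ∘ (a ∷_)) g (z ∘ (a ∷_)) w))

  -- Only a splitting whose left factor has length `p` can contribute. If `w` is shorter than `p`
  -- there is none, and the right side vanishes too because `List.take p w` is `w`.
  conv-homogeneousˡ : ∀ p (f g : List X → ℤ) → (∀ x → length x ≢ p → f x ≡ 0ℤ) →
                      ∀ w → conv f g w ≡ f (List.take p w) ℤ.* g (List.drop p w)
  conv-homogeneousˡ zero    f g z []      = conv-[] f g
  conv-homogeneousˡ (suc p) f g z []      = conv-[] f g
  conv-homogeneousˡ zero    f g z (a ∷ w) = trans (conv-∷ f g a w)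
    (trans (cong (λ s → f [] ℤ.* g (a ∷ w) ℤ.+ s)
                 (conv-zeroˡ (f ∘ (a ∷_)) g (λ x → z (a ∷ x) (λ ())) w))
           (ℤₚ.+-identityʳ _))
  conv-homogeneousˡ (suc p) f g z (a ∷ w) = trans (conv-∷ f g a w)
    (trans (cong₂ ℤ._+_ (cong (ℤ._* g (a ∷ w)) (z [] (λ ())))
                        (conv-homogeneousˡ p (f ∘ (a ∷_)) g
                          (λ x ≢p → z (a ∷ x) (≢p ∘ ℕₚ.suc-injective)) w))
           (ℤₚ.+-identityˡ _))

-- The product rule and the subalgebra

module _ {l p q : ℕ} (σ′ : Permutation′ p) (u′ : Vec (C l) p) (σ″ : Permutation′ q) (u″ : Vec (C l) q) where

  -- Each coefficient is an indicator: homogeneity reduces the left side to one splitting,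
  -- disjointness reduces the right side to the existence of a matching term, and the two conditions
  -- are equivalent.
  𝐆-⊠ : 𝐆 (σ′ & u′) ⊠ 𝐆 (σ″ & u″) ≋ (∑[ σ ∈ convolution σ′ σ″ ] 𝐆 (σ & u′ ++ u″))
  𝐆-⊠ w = begin
    coeff (𝐆 (σ′ & u′) ⊠ 𝐆 (σ″ & u″)) w
      ≡⟨ conv-homogeneousˡ p (coeff (𝐆 (σ′ & u′))) (coeff (𝐆 (σ″ & u″)))
           (λ x ≢p → indicator-no (Std x ≟ᶜ (σ′ & u′)) (≢p ∘ ≈ᶜ⇒size≡)) w ⟩
    indicator prefix? ℤ.* indicator suffix?
      ≡⟨ indicator-× prefix? suffix? ⟨
    indicator (prefix? ×-dec suffix?)
      ≡⟨ indicator-cong (factors⇒convolution σ′ u′ σ″ u″ w) (convolution⇒factors σ′ u′ σ″ u″ w)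
           (prefix? ×-dec suffix?) (any? match? (convolution σ′ σ″)) ⟩
    indicator (any? match? (convolution σ′ σ″))
      ≡⟨ sum-indicator match? disjoint ⟨
    sumℤ (List.map (λ σ → indicator (match? σ)) (convolution σ′ σ″))
      ≡⟨ coeff-∑ (convolution σ′ σ″) (λ σ → 𝐆 (σ & u′ ++ u″)) w ⟨
    coeff (∑[ σ ∈ convolution σ′ σ″ ] 𝐆 (σ & u′ ++ u″)) w ∎
    where
    open ≡-Reasoning
    prefix? = Std (List.take p w) ≟ᶜ (σ′ & u′)
    suffix? = Std (List.drop p w) ≟ᶜ (σ″ & u″)

    match? : ∀ σ → Dec (Std w ≈ᶜ (σ & u′ ++ u″))
    match? σ = Std w ≟ᶜ (σ & u′ ++ u″)

    disjoint : AllPairs (λ σ τ → ¬ (Std w ≈ᶜ (σ & u′ ++ u″) × Std w ≈ᶜ (τ & u′ ++ u″))) (convolution σ′ σ″)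
    -- Two matches would make `σ` and `τ` equivalent, but the enumeration has no repetitions up to
    -- `Perm.≈` and filtering keeps this.
    disjoint = AllPairs.map (λ σ≉τ (d , e) → σ≉τ (≈ᶜ⇒≈ d e))
      (AllPairsₚ.filter⁺ (inConvolution? σ′ σ″) (permutations-distinct (p + q)))

module _ {l : ℕ} where

  -- The unit is itself a quasi-ribbon, that of the colored permutation of size 0, as the empty word
  -- is the only word of length 0.
  𝟙∈Span-𝐆 : Span (𝐆 {l}) 𝟙
  𝟙∈Span-𝐆 = (1ℤ , ε) ∷ [] , λ w → sym (trans (ℤₚ.+-identityʳ _) (trans (ℤₚ.*-identityˡ _) (coeff-𝐆-ε w)))
    where
    ε : ColoredPermutation l
    ε = Perm.id & []

    coeff-𝐆-ε : 𝐆 ε ≋ 𝟙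
    coeff-𝐆-ε []      = refl
    coeff-𝐆-ε (a ∷ w) = indicator-no (Std (a ∷ w) ≟ᶜ ε) ((λ ()) ∘ ≈ᶜ⇒size≡)

  𝐆-⊠∈Span-𝐆 : ∀ π ρ → Span (𝐆 {l}) (𝐆 π ⊠ 𝐆 ρ)
  𝐆-⊠∈Span-𝐆 (σ′ & u′) (σ″ & u″) =
    Span-resp-≋ 𝐆 (∑[ σ ∈ convolution σ′ σ″ ] 𝐆 (σ & u′ ++ u″)) (𝐆 (σ′ & u′) ⊠ 𝐆 (σ″ & u″))
      (λ w → sym (𝐆-⊠ σ′ u′ σ″ u″ w))
      (Span-∑ 𝐆 (λ σ → σ & u′ ++ u″) (convolution σ′ σ″))

theorem2p2 : (l : ℕ) → 1 ≤ l →
    (∀ {p q} (σ′ : Permutation′ p) (u′ : Vec (C l) p) (σ″ : Permutation′ q) (u″ : Vec (C l) q) →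
    𝐆 (σ′ & u′) ⊠ 𝐆 (σ″ & u″) ≋ (∑[ σ ∈ convolution σ′ σ″ ] 𝐆 (σ & u′ ++ u″)))
    × IsSubalgebra (Span (𝐆 {l}))
theorem2p2 l _ = 𝐆-⊠ , Span-isSubalgebra (𝐆 {l}) 𝟙∈Span-𝐆 𝐆-⊠∈Span-𝐆
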